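{- For every boundedly branching computable transition system $T$ there exists a reactive Turing machine $M$ such that $T\leftrightarrow_b^\Delta\mathcal{T}(M)$.
   Context: Fix a finite set $\mathcal{A}$ of action symbols and $\tau\notin\mathcal{A}$; $\mathcal{A}_\tau=\mathcal{A}\cup\{\tau\}$. Fix a finite set $\mathcal{D}$ of data symbols and a blank $\Box\notin\mathcal{D}$; $\mathcal{D}_\Box=\mathcal{D}\cup\{\Box\}$. A transition system is $T=(S,\to,\uparrow,\downarrow)$ with state set $S$, $\to\subseteq S\times\mathcal{A}_\tau\times S$, initial state $\uparrow$, final states $\downarrow\subseteq S$. A reactive Turing machine (RTM) is $M=(S,\to,\uparrow,\downarrow)$ with $S$ finite, $\uparrow\in S$, $\downarrow\subseteq S$, $\to\subseteq S\times\mathcal{D}_\Box\times\mathcal{A}_\tau\times\mathcal{D}_\Box\times\{L,R\}\times S$ (write $s\xrightarrow{d/a/e,X}t$). A tape instance is a finite sequence over $\mathcal{D}_\Box$ and marked symbols $\check d$ ($d\in\mathcal{D}_\Box$) with exactly one marked symbol, identified modulo blanks added/removed at the ends; for $\delta\in\mathcal{D}_\Box^*$, $\overleftarrow{\delta}$ (resp. $\overrightarrow{\delta}$) is $\delta$ with rightmost (resp. leftmost) symbol marked, or $\check\Box$ if $\delta$ is empty. $\mathcal{T}(M)$ is the transition system with states the configurations $(s,\delta)$, transitions $(s,\delta_L\check d\delta_R)\xrightarrow{a}(t,\overleftarrow{\delta_L}e\delta_R)$ iff $s\xrightarrow{d/a/e,L}t$ and $(s,\delta_L\check d\delta_R)\xrightarrow{a}(t,\delta_Le\overrightarrow{\delta_R})$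 iff $s\xrightarrow{d/a/e,R}t$, initial state $(\uparrow,\check\Box)$, final states $\{(s,\delta)\mid s\in\downarrow\}$. $\mathit{out}(s)=\{(a,t)\mid s\xrightarrow{a}t\}$. $T$ is finitely branching if all $\mathit{out}(s)$ are finite; it has branching degree bounded by $B\in\mathbb{N}$ if $|\mathit{out}(s)|\le B$ for all $s$, and is boundedly branching if this holds for some $B$. With fixed injective codings of $\mathcal{A}_\tau$ and of the states into $\mathbb{N}$, a finitely branching $T$ is computable if $\mathit{out}$ and the characteristic function of the final states are recursive. Branching bisimilarity: write $s\xrightarrow{(a)}t$ if $s\xrightarrow{a}t$, or $a=\tau$ and $s=t$; $\twoheadrightarrow$ is the reflexive-transitive and $\twoheadrightarrow^+$ the transitive closure of $\xrightarrow{\tau}$. A branching bisimulation from $T_1$ to $T_2$ is a relation $\mathcal{R}$ between their states such that $s_1\mathcal{R}s_2$ implies: (1) if $s_1\xrightarrow{a}s_1'$ then there are $s_2'',s_2'$ with $s_2\twoheadrightarrow s_2''\xrightarrow{(a)}s_2'$, $s_1\mathcal{R}s_2''$, $s_1'\mathcal{R}s_2'$; (2) symmetrically for transitions of $s_2$; (3) if $s_1$ is final then $s_2\twoheadrightarrow s_2'$ for some final $s_2'$ with $s_1\mathcal{R}s_2'$; (4) symmetrically. It is divergence-preserving if moreover $s_1\mathcal{R}s_2$ implies: (5) if there is an infinite sequence $s_1=s_{1,0}\xrightarrow{\tau}s_{1,1}\xrightarrow{\tau}\cdots$ with $s_{1,i}\mathcal{R}s_2$ for all $i$, then $s_2\twoheadrightarrow^+s_2'$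 with $s_{1,i}\mathcal{R}s_2'$ for some $i$; (6) symmetrically. $T_1\leftrightarrow_b^\Delta T_2$ (divergence-preserving branching bisimilar) if there is a divergence-preserving branching bisimulation relating the initial states.
   Formalization: The set of data symbols is assumed nonempty; with no data symbols the tape holds only blanks, every reactive Turing machine has a finite transition system, and the claim fails for infinite-state systems. -}

module Defs where

open import Data.Nat using (ℕ; zero; suc; _+_; _≤_)
open import Data.Fin using (Fin)
open import Data.Maybe using (Maybe; just; nothing)
open import Data.Bool using (Bool; true; false; not; T)
open import Data.Unit using (tt)
open import Data.Empty using (⊥)
open import Data.Vec using (Vec; []; _∷_; lookup)
open import Data.List using (List; []; _∷_; length)
open import Data.List.Membership.Propositional using (_∈_)
open import Data.List.Relation.Unary.All using (All)
open import Data.List.Relation.Unary.Unique.Propositional using (Unique)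
open import Data.Product using (Σ; ∃; _×_; _,_)
open import Data.Sum using (_⊎_)
open import Relation.Nullary using (¬_)
open import Relation.Binary.PropositionalEquality using (_≡_)
open import Relation.Binary.Construct.Closure.ReflexiveTransitive using (Star)
open import Function.Bundles using (_⇔_)

Act : ℕ → Set
Act nA = Maybe (Fin nA)

τ : ∀ {nA} → Act nA
τ = nothing

Dat : ℕ → Set
Dat nD = Maybe (Fin nD)

□ : ∀ {nD} → Dat nD
□ = nothing

record TS (nA : ℕ) : Set₁ where
  field
    State  : Set
    _⟶[_]_ : State → Act nA → State → Set
    init   : State
    Final  : State → Set

module _ {nA : ℕ} (𝑻 : TS nA) where
  open TS 𝑻

  _⟶⟨_⟩_ : State → Act nA → State → Set
  s ⟶⟨ a ⟩ t = (s ⟶[ a ] t) ⊎ (a ≡ τ × s ≡ t)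

  τstep : State → State → Set
  τstep s t = s ⟶[ τ ] t

  _↠_ : State → State → Set
  _↠_ = Star τstep

  _↠⁺_ : State → State → Set
  s ↠⁺ t = Σ State λ u → τstep s u × (u ↠ t)

  BoundedlyBranching : Set
  BoundedlyBranching =
    ∃ λ (B : ℕ) → ∀ (s : State) (l : List (Act nA × State)) →
      Unique l → All (λ p → s ⟶[ Data.Product.proj₁ p ] Data.Product.proj₂ p) l →
      length l ≤ B

data PR : ℕ → Set where
  Zc : ∀ {n} → PR n
  Sc : PR 1
  Pc : ∀ {n} → Fin n → PR n
  Cc : ∀ {m n} → PR m → Vec (PR n) m → PR n
  Rc : ∀ {n} → PR n → PR (suc (suc n)) → PR (suc n)
  Mc : ∀ {n} → PR (suc n) → PR n

data _[_]⇓_ : ∀ {n} → PR n → Vec ℕ n → ℕ → Set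
data _[_]⇓*_ : ∀ {m n} → Vec (PR n) m → Vec ℕ n → Vec ℕ m → Set
data Search {n : ℕ} (f : PR (suc n)) (xs : Vec ℕ n) : ℕ → ℕ → Set

data _[_]⇓_ where
  zE : ∀ {n} {xs : Vec ℕ n} → Zc [ xs ]⇓ 0
  sE : ∀ {x} → Sc [ x ∷ [] ]⇓ suc x
  pE : ∀ {n} {i : Fin n} {xs} → Pc i [ xs ]⇓ lookup xs i
  cE : ∀ {m n} {f : PR m} {gs : Vec (PR n) m} {xs ys y} →
       gs [ xs ]⇓* ys → f [ ys ]⇓ y → Cc f gs [ xs ]⇓ y
  r0 : ∀ {n} {f : PR n} {g xs y} → f [ xs ]⇓ y → Rc f g [ 0 ∷ xs ]⇓ y
  rS : ∀ {n} {f : PR n} {g k xs z y} →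
       Rc f g [ k ∷ xs ]⇓ z → g [ k ∷ z ∷ xs ]⇓ y → Rc f g [ suc k ∷ xs ]⇓ y
  mE : ∀ {n} {f : PR (suc n)} {xs y} → Search f xs 0 y → Mc f [ xs ]⇓ y

data _[_]⇓*_ where
  []  : ∀ {n} {xs : Vec ℕ n} → [] [ xs ]⇓* []
  _∷_ : ∀ {m n} {g : PR n} {gs : Vec (PR n) m} {xs y ys} →
        g [ xs ]⇓ y → gs [ xs ]⇓* ys → (g ∷ gs) [ xs ]⇓* (y ∷ ys)

data Search {n} f xs where
  found : ∀ {k} → f [ k ∷ xs ]⇓ 0 → Search f xs k k
  next  : ∀ {k w y} → f [ k ∷ xs ]⇓ suc w → Search f xs (suc k) y → Search f xs k y

Total : PR 1 → Set
Total f = ∀ x → ∃ λ y → f [ x ∷ [] ]⇓ y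

tri : ℕ → ℕ
tri zero    = zero
tri (suc n) = suc n + tri n

pair : ℕ → ℕ → ℕ
pair x y = tri (x + y) + y

listCode : List ℕ → ℕ
listCode []       = 0
listCode (x ∷ xs) = suc (pair x (listCode xs))

codeAct : ∀ {nA} → Act nA → ℕ
codeAct nothing  = 0
codeAct (just a) = suc (Data.Fin.toℕ a)

Injective : {A : Set} → (A → ℕ) → Set
Injective {A} c = ∀ {x y : A} → c x ≡ c y → x ≡ y

record Computable {nA : ℕ} (𝑻 : TS nA) : Set where
  open TS 𝑻
  field
    code     : State → ℕ
    code-inj : Injective code
    outF     : PR 1
    outF-tot : Total outF
    outF-ok  : ∀ (s : State) → ∃ λ (l : List ℕ) →
                 (outF [ code s ∷ [] ]⇓ listCode l) ×
                 (∀ m → (m ∈ l) ⇔ (∃ λ (a : Act nA) → ∃ λ (t : State) →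
                                      (s ⟶[ a ] t) × (m ≡ pair (codeAct a) (code t))))
    finF     : PR 1
    finF-tot : Total finF
    finF-ok  : ∀ (s : State) →
                 (Final s × finF [ code s ∷ [] ]⇓ 1) ⊎
                 ((¬ Final s) × finF [ code s ∷ [] ]⇓ 0)

data Dir : Set where
  L R : Dir

record RTM (nA nD : ℕ) : Set where
  field
    nS    : ℕ
    start : Fin nS
    final : Fin nS → Bool
    rules : List (Fin nS × Dat nD × Act nA × Dat nD × Dir × Fin nS)

-- Tape instances modulo blanks at the ends are represented canonically as
-- (left part, marked symbol, right part); each side is listed starting
-- next to the head, and has no blank at its far end.
module Tape (nD : ℕ) where

  isBlank : Dat nD → Bool
  isBlank nothing  = true
  isBlank (just _) = false

  ok : List (Dat nD) → Bool
  ok []           = true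
  ok (x ∷ [])     = not (isBlank x)
  ok (_ ∷ y ∷ ys) = ok (y ∷ ys)

  Side : Set
  Side = Σ (List (Dat nD)) (λ l → T (ok l))

  emptySide : Side
  emptySide = [] , tt

  push : Dat nD → Side → Side
  push nothing  ([] , p)     = [] , tt
  push (just d) ([] , p)     = (just d ∷ []) , tt
  push x        ((y ∷ ys) , p) = (x ∷ y ∷ ys) , p

  popSym : Side → Dat nD
  popSym ([] , _)    = nothing
  popSym ((x ∷ _) , _) = x

  popRest : Side → Side
  popRest ([] , p)          = [] , p
  popRest ((_ ∷ []) , p)    = [] , tt
  popRest ((_ ∷ y ∷ ys) , p) = (y ∷ ys) , p

module _ {nA nD : ℕ} (M : RTM nA nD) where
  open RTM M
  open Tape nD

  Config : Set
  Config = Fin nS × Side × Dat nD × Side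

  data Step : Config → Act nA → Config → Set where
    stepL : ∀ {s d a e t l r} → (s , d , a , e , L , t) ∈ rules →
            Step (s , l , d , r) a (t , popRest l , popSym l , push e r)
    stepR : ∀ {s d a e t l r} → (s , d , a , e , R , t) ∈ rules →
            Step (s , l , d , r) a (t , push e l , popSym r , popRest r)

  𝒯 : TS nA
  𝒯 = record
    { State  = Config
    ; _⟶[_]_ = Step
    ; init   = start , emptySide , □ , emptySide
    ; Final  = λ c → T (final (Data.Product.proj₁ c))
    }

module _ {nA : ℕ} (T₁ T₂ : TS nA) where
  private
    module 𝟙 = TS T₁
    module 𝟚 = TS T₂

  OneSided : (𝓡 : 𝟙.State → 𝟚.State → Set) → Set
  OneSided 𝓡 =
    (∀ {s₁ s₂ a s₁'} → 𝓡 s₁ s₂ → s₁ 𝟙.⟶[ a ] s₁' →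
       ∃ λ s₂'' → ∃ λ s₂' → _↠_ T₂ s₂ s₂'' × _⟶⟨_⟩_ T₂ s₂'' a s₂' ×
                           𝓡 s₁ s₂'' × 𝓡 s₁' s₂')
    × (∀ {s₁ s₂} → 𝓡 s₁ s₂ → 𝟙.Final s₁ →
       ∃ λ s₂' → _↠_ T₂ s₂ s₂' × 𝟚.Final s₂' × 𝓡 s₁ s₂')
    × (∀ {s₁ s₂} → 𝓡 s₁ s₂ → (f : ℕ → 𝟙.State) → f 0 ≡ s₁ →
       (∀ i → f i 𝟙.⟶[ τ ] f (suc i)) → (∀ i → 𝓡 (f i) s₂) →
       ∃ λ s₂' → _↠⁺_ T₂ s₂ s₂' × ∃ λ i → 𝓡 (f i) s₂')

module _ {nA : ℕ} where
  IsDPBranchingBisim : (T₁ T₂ : TS nA) → (TS.State T₁ → TS.State T₂ → Set) → Set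
  IsDPBranchingBisim T₁ T₂ 𝓡 =
    OneSided T₁ T₂ 𝓡 × OneSided T₂ T₁ (λ s₂ s₁ → 𝓡 s₁ s₂)

  _↔bΔ_ : TS nA → TS nA → Set₁
  T₁ ↔bΔ T₂ = ∃ λ (𝓡 : TS.State T₁ → TS.State T₂ → Set) →
                IsDPBranchingBisim T₁ T₂ 𝓡 × 𝓡 (TS.init T₁) (TS.init T₂)

{-# OPTIONS --safe #-}
module Submission where

-- Partial recursive functions are compiled to tape programs acting on a stack of unary numbers. The
-- machine keeps the code of the current state s of T on the tape, computes from it the finality of s
-- and the labels of its (at most B) distinct outgoing edges, and remembers them in its control: this
-- choice configuration alone offers all the moves of s. A move is followed by the computation of the
-- code of the target. Since every phase between two choice configurations is a deterministic
-- terminating τ-run, relating s to the configurations on the runs into its choice configuration is a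
-- branching bisimulation, and an infinite τ-run must pass a choice configuration.

open import Defs
open import Data.Nat
  using (ℕ; zero; suc; pred; _+_; _∸_; _≤_; _<_; _≤′_; ≤′-refl; ≤′-step; z≤n; s≤s; s≤s⁻¹)
open import Data.Nat.Properties
open import Data.Fin as Fin using (Fin; toℕ; fromℕ<; #_)
open import Data.Fin.Properties using (toℕ-injective; toℕ-fromℕ<)
open import Data.Bool using (Bool; true; false; T)
open import Data.Maybe using (Maybe; just; nothing)
open import Data.Maybe.Properties using (just-injective)
open import Data.Unit using (⊤; tt)
open import Data.Vec using (Vec; []; _∷_; lookup; head; tail; tabulate; toList)
open import Data.Vec.Properties using (lookup∘tabulate)
open import Data.List as List using (List; []; _∷_; _++_; map; concatMap; length; allFin)
open import Data.List.Membership.Propositional using (_∈_; lose; find)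
open import Data.List.Membership.Propositional.Properties
  using (∈-map⁺; ∈-map⁻; ∈-concatMap⁺; ∈-concatMap⁻; ∈-allFin; ∈-++⁺ˡ; ∈-++⁺ʳ)
open import Data.List.Relation.Unary.All as All using (All; []; _∷_)
open import Data.List.Relation.Unary.AllPairs using ([]; _∷_)
open import Data.List.Relation.Unary.Any as Any using (here; there)
open import Data.List.Relation.Unary.Any.Properties using (lookup-index)
open import Data.List.Relation.Unary.Unique.Propositional using (Unique)
open import Data.Product using (Σ; ∃; _×_; _,_; proj₁; proj₂; map₂)
open import Data.Sum using (_⊎_; inj₁; inj₂)
open import Function.Bundles using (Equivalence)
open import Relation.Nullary using (contradiction)
open import Relation.Binary.Construct.Closure.ReflexiveTransitive using (ε; _◅_)
open import Relation.Binary.PropositionalEquality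

-- If the machine picked among the moves of s by τ-steps, a pick would discard alternatives that s
-- still has. Hence one configuration has to carry all moves, and a finite control can hold only
-- their labels. The targets, unbounded in number, are named by slot numbers and recomputed after
-- the move. The list coded by the value of `outF` may repeat members and so be longer than B; the
-- slots are therefore filled by strictly decreasing edge codes, which makes B slots enough. On the
-- tape the blank is both the separator and the unwritten rest, so the bottom of the stack looks
-- like further zeros; for this reason all stack depths are fixed when a program is compiled.

-- Finite types.

record Finite (A : Set) : Set where
  field
    elements : List A
    complete : ∀ a → a ∈ elements
open Finite

finite-⊤ : Finite ⊤
finite-⊤ .elements = tt ∷ []
finite-⊤ .complete _ = here refl

finite-Bool : Finite Bool
finite-Bool .elements = false ∷ true ∷ []
finite-Bool .complete false = here refl
finite-Bool .complete true = there (here refl)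

finite-Fin : ∀ {n} → Finite (Fin n)
finite-Fin .elements = allFin _
finite-Fin .complete = ∈-allFin

finite-Maybe : ∀ {A} → Finite A → Finite (Maybe A)
finite-Maybe F .elements = nothing ∷ map just (F .elements)
finite-Maybe F .complete nothing = here refl
finite-Maybe F .complete (just a) = there (∈-map⁺ just (F .complete a))

finite-⊎ : ∀ {A B} → Finite A → Finite B → Finite (A ⊎ B)
finite-⊎ F G .elements = map inj₁ (F .elements) ++ map inj₂ (G .elements)
finite-⊎ F G .complete (inj₁ a) = ∈-++⁺ˡ (∈-map⁺ inj₁ (F .complete a))
finite-⊎ F G .complete (inj₂ b) = ∈-++⁺ʳ _ (∈-map⁺ inj₂ (G .complete b))

finite-Σ : ∀ {A} {B : A → Set} → Finite A → (∀ a → Finite (B a)) → Finite (Σ A B)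
finite-Σ F G .elements = concatMap (λ a → map (a ,_) (G a .elements)) (F .elements)
finite-Σ F G .complete (a , b) =
  ∈-concatMap⁺ (λ a → map (a ,_) (G a .elements)) (lose (F .complete a) (∈-map⁺ (a ,_) (G a .complete b)))

finite-Vec : ∀ {A} n → Finite A → Finite (Vec A n)
finite-Vec zero F .elements = [] ∷ []
finite-Vec zero F .complete [] = here refl
finite-Vec (suc n) F .elements = map (λ (a , v) → a ∷ v) (finite-Σ F (λ _ → finite-Vec n F) .elements)
finite-Vec (suc n) F .complete (a ∷ v) =
  ∈-map⁺ (λ (a , v) → a ∷ v) (finite-Σ F (λ _ → finite-Vec n F) .complete (a , v))

-- Tape programs

module Machines (nD : ℕ) where

  open Tape (suc nD)

  Sym : Set
  Sym = Dat (suc nD)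

  pattern blank = nothing
  pattern mark = just Fin.zero

  Tp : Set
  Tp = Side × Sym × Side

  move : Tp → Sym → Dir → Tp
  move (l , d , r) e L = popRest l , popSym l , push e r
  move (l , d , r) e R = push e l , popSym r , popRest r

  -- Leaving is not a state of its own: a transition leads to a state or straight to an exit, and
  -- `entry` may already be an exit. So `ret` takes no step and sequencing inserts no transitions.
  record Mach (E : Set) : Set₁ where
    field
      Q      : Set
      finite : Finite Q
      entry  : Q ⊎ E
      δ      : Q → Sym → Sym × Dir × (Q ⊎ E)
  open Mach public

  data Run {E} (m : Mach E) : Q m ⊎ E → Tp → E → Tp → Set where
    exit : ∀ {e t} → Run m (inj₂ e) t e t
    step : ∀ {q t e t′} →
           (let (w , X , n) = δ m q (proj₁ (proj₂ t))) →
           Run m n (move t w X) e t′ → Run m (inj₁ q) t e t′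

  record Runs {E} (m : Mach E) (t : Tp) (e : E) (t′ : Tp) : Set where
    constructor runs
    field run : Run m (entry m) t e t′
  open Runs public

  from-≡ : ∀ {E} {m : Mach E} {t u e t′} → t ≡ u → Runs m u e t′ → Runs m t e t′
  from-≡ refl r = r

  to-≡ : ∀ {E} {m : Mach E} {t e u t′} → u ≡ t′ → Runs m t e u → Runs m t e t′
  to-≡ refl r = r

  ret : ∀ {E} → E → Mach E
  ret e .Q = Fin 0
  ret e .finite = finite-Fin
  ret e .entry = inj₂ e
  ret e .δ ()

  done : ∀ {E} {e : E} {t} → Runs (ret e) t e t
  done = runs exit

  one : ∀ {E} → (Sym → Sym × Dir × E) → Mach E
  one f .Q = ⊤
  one f .finite = finite-⊤
  one f .entry = inj₁ tt
  one f .δ _ d = map₂ (map₂ inj₂) (f d)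

  module _ {E F : Set} (fin : Finite E) (m : Mach E) (k : E → Mach F) where

    enter : ∀ e → Q (k e) ⊎ F → (Q m ⊎ Σ E (λ e → Q (k e))) ⊎ F
    enter e (inj₁ q) = inj₁ (inj₂ (e , q))
    enter e (inj₂ f) = inj₂ f

    resume : Q m ⊎ E → (Q m ⊎ Σ E (λ e → Q (k e))) ⊎ F
    resume (inj₁ q) = inj₁ (inj₁ q)
    resume (inj₂ e) = enter e (entry (k e))

    bind : Mach F
    bind .Q = Q m ⊎ Σ E (λ e → Q (k e))
    bind .finite = finite-⊎ (finite m) (finite-Σ fin (λ e → finite (k e)))
    bind .entry = resume (entry m)
    bind .δ (inj₁ q) d = map₂ (map₂ resume) (δ m q d)
    bind .δ (inj₂ (e , q)) d = map₂ (map₂ (enter e)) (δ (k e) q d)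

    run-enter : ∀ {e x t f t′} → Run (k e) x t f t′ → Run bind (enter e x) t f t′
    run-enter exit = exit
    run-enter (step r) = step (run-enter r)

    run-resume : ∀ {x t e t′ f t″} → Run m x t e t′ → Runs (k e) t′ f t″ → Run bind (resume x) t f t″
    run-resume exit r = run-enter (run r)
    run-resume (step r) r′ = step (run-resume r r′)

  infixr 5 _>>_ _>>ᵇ_ _⟫_

  _>>_ : ∀ {F} → Mach ⊤ → Mach F → Mach F
  m >> n = bind finite-⊤ m (λ _ → n)

  _>>ᵇ_ : ∀ {F} → Mach Bool → (Bool → Mach F) → Mach F
  m >>ᵇ k = bind finite-Bool m k

  _⟫_ : ∀ {E F} {fin : Finite E} {m : Mach E} {k : E → Mach F} {t e t′ f t″} →
        Runs m t e t′ → Runs (k e) t′ f t″ → Runs (bind fin m k) t f t″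
  r ⟫ r′ = runs (run-resume _ _ _ (run r) r′)

  -- The extra state nothing is a sink, reached only if the body leaves at once with nothing.
  module _ {E : Set} (m : Mach (Maybe E)) where

    start : Q m ⊎ Maybe E → Maybe (Q m) ⊎ E
    start (inj₁ q) = inj₁ (just q)
    start (inj₂ (just e)) = inj₂ e
    start (inj₂ nothing) = inj₁ nothing

    again : Q m ⊎ Maybe E → Maybe (Q m) ⊎ E
    again (inj₁ q) = inj₁ (just q)
    again (inj₂ (just e)) = inj₂ e
    again (inj₂ nothing) = start (entry m)

    -- `δ` continues through `again`, while the loop is entered through `start`, which cannot
    -- restart an empty body forever. Their agreement on `entry m` lets the inductions on runs be
    -- done for `again` alone.
    again≡start : again (entry m) ≡ start (entry m)
    again≡start with entry m in eq
    ... | inj₁ q = refl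
    ... | inj₂ (just e) = refl
    ... | inj₂ nothing = cong start eq

    loop : Mach E
    loop .Q = Maybe (Q m)
    loop .finite = finite-Maybe (finite m)
    loop .entry = start (entry m)
    loop .δ nothing d = d , R , inj₁ nothing
    loop .δ (just q) d = map₂ (map₂ again) (δ m q d)

    run-again : ∀ {x t t′ e t″} → Run m x t nothing t′ → Runs loop t′ e t″ → Run loop (again x) t e t″
    run-again exit r = run r
    run-again (step r) r′ = step (run-again r r′)

    run-stop : ∀ {x t e t′} → Run m x t (just e) t′ → Run loop (again x) t e t′
    run-stop exit = exit
    run-stop (step r) = step (run-stop r)

    loop-more : ∀ {t t′ e t″} → Runs m t nothing t′ → Runs loop t′ e t″ → Runs loop t e t″
    loop-more r r′ = runs (subst (λ x → Run loop x _ _ _) again≡start (run-again (run r) r′))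

    loop-done : ∀ {t e t′} → Runs m t (just e) t′ → Runs loop t e t′
    loop-done r = runs (subst (λ x → Run loop x _ _ _) again≡start (run-stop (run r)))

  -- The tape between two cells: ⟨ l ∣ r ⟩ʳ has the head right of the gap, ⟨ l ∣ r ⟩ˡ left of it.
  ⟨_∣_⟩ʳ ⟨_∣_⟩ˡ : Side → Side → Tp
  ⟨ l ∣ r ⟩ʳ = l , popSym r , popRest r
  ⟨ l ∣ r ⟩ˡ = popRest l , popSym l , r

  popSym-push : ∀ d s → popSym (push d s) ≡ d
  popSym-push nothing ([] , _) = refl
  popSym-push (just _) ([] , _) = refl
  popSym-push nothing (_ ∷ _ , _) = refl
  popSym-push (just _) (_ ∷ _ , _) = refl

  popRest-push : ∀ d s → popRest (push d s) ≡ s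
  popRest-push nothing ([] , _) = refl
  popRest-push (just _) ([] , _) = refl
  popRest-push nothing (_ ∷ _ , _) = refl
  popRest-push (just _) (_ ∷ _ , _) = refl

  headʳ : ∀ l d r → ⟨ l ∣ push d r ⟩ʳ ≡ (l , d , r)
  headʳ l d r = cong₂ (λ d r → l , d , r) (popSym-push d r) (popRest-push d r)

  headˡ : ∀ l d r → ⟨ push d l ∣ r ⟩ˡ ≡ (l , d , r)
  headˡ l d r = cong₂ (λ d l → l , d , r) (popSym-push d l) (popRest-push d l)

  module _ {E : Set} (f : Sym → Sym × Dir × E) where

    one-at : ∀ {l d r} → (let (w , X , e) = f d) → Runs (one f) (l , d , r) e (move (l , d , r) w X)
    one-at = runs (step exit)

    oneʳ : ∀ l d r → (let (w , X , e) = f d) → Runs (one f) ⟨ l ∣ push d r ⟩ʳ e (move (l , d , r) w X)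
    oneʳ l d r = from-≡ (headʳ l d r) one-at

    oneˡ : ∀ l d r → (let (w , X , e) = f d) → Runs (one f) ⟨ push d l ∣ r ⟩ˡ e (move (l , d , r) w X)
    oneˡ l d r = from-≡ (headˡ l d r) one-at

  -- Stacks of unary numbers and their basic operations.

  ones : ℕ → Side → Side
  ones zero s = s
  ones (suc n) s = push mark (ones n s)

  ones-suc : ∀ n s → ones n (push mark s) ≡ ones (suc n) s
  ones-suc zero s = refl
  ones-suc (suc n) s = cong (push mark) (ones-suc n s)

  -- A stack of numbers lies left of the head, its top next to the head; every number is written in
  -- unary and has a blank to its left.
  enc : List ℕ → Side → Side
  enc [] s = s
  enc (v ∷ vs) s = ones v (push blank (enc vs s))

  -- The same blocks after the head has crossed them leftwards; the blank of each number still lies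
  -- to its left.
  encᵣ : List ℕ → Side → Side
  encᵣ [] r = r
  encᵣ (v ∷ vs) r = encᵣ vs (push blank (ones v r))

  opaque
    stack : List ℕ → Tp
    stack σ = ⟨ enc σ emptySide ∣ emptySide ⟩ʳ

  enc-++ : ∀ vs ws s → enc (vs ++ ws) s ≡ enc vs (enc ws s)
  enc-++ [] ws s = refl
  enc-++ (v ∷ vs) ws s = cong (λ z → ones v (push blank z)) (enc-++ vs ws s)

  -- The parameter is what the separator becomes: `blank` merely crosses the number, `mark` fills
  -- the gap, which restores the 1 blanked during copying and also serves to shift a number.
  blockˡ : Sym → Mach ⊤
  blockˡ w = loop (one λ { blank → w , L , just tt ; (just _) → mark , L , nothing })

  blockˡ-run : ∀ w v l r → Runs (blockˡ w) ⟨ ones v (push blank l) ∣ r ⟩ˡ tt ⟨ l ∣ push w (ones v r) ⟩ˡ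
  blockˡ-run w zero l r = loop-done _ (oneˡ _ l blank r)
  blockˡ-run w (suc v) l r = loop-more _ (oneˡ _ _ mark r)
    (to-≡ (cong (λ z → ⟨ l ∣ push w z ⟩ˡ) (ones-suc v r)) (blockˡ-run w v l (push mark r)))

  blockʳ : Mach ⊤
  blockʳ = loop (one λ { blank → blank , R , just tt ; (just _) → mark , R , nothing })

  blockʳ-run : ∀ v l r → Runs blockʳ ⟨ l ∣ ones v (push blank r) ⟩ʳ tt ⟨ push blank (ones v l) ∣ r ⟩ʳ
  blockʳ-run zero l r = loop-done _ (oneʳ _ l blank r)
  blockʳ-run (suc v) l r = loop-more _ (oneʳ _ l mark _)
    (to-≡ (cong (λ z → ⟨ push blank z ∣ r ⟩ʳ) (ones-suc v l)) (blockʳ-run v (push mark l) r))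

  times : ℕ → Mach ⊤ → Mach ⊤
  times zero m = ret tt
  times (suc n) m = m >> times n m

  blocksˡ-run : ∀ vs l r →
    Runs (times (length vs) (blockˡ blank)) ⟨ enc vs l ∣ r ⟩ˡ tt ⟨ l ∣ encᵣ vs r ⟩ˡ
  blocksˡ-run [] l r = done
  blocksˡ-run (v ∷ vs) l r = blockˡ-run blank v _ r ⟫ blocksˡ-run vs l _

  turn : Mach ⊤
  turn = one λ d → d , L , tt

  turn-run : ∀ l r → Runs turn ⟨ l ∣ push blank r ⟩ʳ tt ⟨ l ∣ push blank r ⟩ˡ
  turn-run l r = oneʳ _ l blank r

  opaque
    unfolding stack

    push0 inc : Mach ⊤
    push0 = one λ _ → blank , R , tt
    inc = one λ _ → mark , R , tt

    push0-run : ∀ σ → Runs push0 (stack σ) tt (stack (0 ∷ σ))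
    push0-run σ = oneʳ _ _ blank emptySide

    inc-run : ∀ v σ → Runs inc (stack (v ∷ σ)) tt (stack (suc v ∷ σ))
    inc-run v σ = oneʳ _ _ blank emptySide

  eat : Mach Bool
  eat = one λ { blank → blank , R , false ; (just _) → blank , R , true }

  opaque
    -- In both cases the head ends one cell further left. A blanked 1 shortens the number; for 0
    -- that cell was the separator, so a negative test also pops the number.
    dec : Mach Bool
    dec = turn >> eat >>ᵇ λ b → turn >> ret b

  -- Cells beyond the end of the tape read as blank, so a head on a last blank already stands on the
  -- free cell after `l`.
  settle : ∀ l → ⟨ push blank l ∣ emptySide ⟩ˡ ≡ ⟨ l ∣ emptySide ⟩ʳ
  settle l = headˡ l blank emptySide

  turn-settle : ∀ l → Runs turn ⟨ push blank l ∣ emptySide ⟩ʳ tt ⟨ l ∣ emptySide ⟩ʳ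
  turn-settle l = to-≡ (settle l) (turn-run _ emptySide)

  opaque
    unfolding stack dec

    dec-zero : ∀ σ → Runs dec (stack (0 ∷ σ)) false (stack σ)
    dec-zero σ = turn-run _ emptySide ⟫ oneˡ _ _ blank emptySide ⟫ turn-settle _ ⟫ done

    dec-suc : ∀ v σ → Runs dec (stack (suc v ∷ σ)) true (stack (v ∷ σ))
    dec-suc v σ = turn-run _ emptySide ⟫ oneˡ _ _ mark emptySide ⟫ turn-settle _ ⟫ done

  -- Seen from the left, a run of 1s ends at the blank to its right, so the remainder at the head
  -- and n further numbers take n + 1 crossings.
  blocksʳ : ℕ → Mach ⊤
  blocksʳ zero = blockʳ
  blocksʳ (suc n) = blocksʳ n >> blockʳ

  blocksʳ-run : ∀ vs j l r → Runs (blocksʳ (length vs))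
    ⟨ l ∣ ones j (encᵣ vs (push blank r)) ⟩ʳ tt ⟨ push blank (enc vs (ones j l)) ∣ r ⟩ʳ
  blocksʳ-run [] j l r = blockʳ-run j l r
  blocksʳ-run (v ∷ vs) j l r = blocksʳ-run vs j l _ ⟫ blockʳ-run v _ r

  fill : Mach ⊤
  fill = one λ _ → mark , L , tt

  shuttle : ℕ → Bool → Mach (Maybe ⊤)
  shuttle k false = blocksʳ (suc k) >> turn >> ret (just tt)
  shuttle k true =
    blocksʳ (suc k) >> turn >> fill >> times (suc k) (blockˡ blank) >> blockˡ mark >> ret nothing

  opaque
    copy : ℕ → Mach ⊤
    copy k = push0 >> turn >> times (suc k) (blockˡ blank) >> loop (eat >>ᵇ shuttle k)

  -- The 1 being copied is blanked to find the way back to it: a ones are still to be copied, j are done.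
  shuttle-run : ∀ vs l a j c → Runs (loop (eat >>ᵇ shuttle (length vs)))
    ⟨ ones a (push blank l) ∣ ones j (encᵣ (c ∷ vs) emptySide) ⟩ˡ tt
    ⟨ enc ((a + c) ∷ vs) (ones (a + j) (push blank l)) ∣ emptySide ⟩ʳ
  shuttle-run vs l zero j c = loop-done _
    (oneˡ _ l blank _ ⟫ blocksʳ-run (c ∷ vs) j _ emptySide ⟫ turn-settle _ ⟫ done)
  shuttle-run vs l (suc a) j c = loop-more _
    (oneˡ _ _ mark _ ⟫ blocksʳ-run (c ∷ vs) j _ emptySide ⟫ turn-run _ emptySide ⟫ oneˡ _ _ blank emptySide
     ⟫ blocksˡ-run (c ∷ vs) _ _ ⟫ blockˡ-run mark j _ _ ⟫ done)
    (from-≡ (cong (λ z → ⟨ ones a (push blank l) ∣ ones (suc j) (encᵣ vs (push blank z)) ⟩ˡ) (ones-suc c emptySide))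
      (to-≡ (cong₂ (λ x y → ⟨ enc (x ∷ vs) (ones y (push blank l)) ∣ emptySide ⟩ʳ) (+-suc a c) (+-suc a j))
        (shuttle-run vs l a (suc j) (suc c))))

  data At : List ℕ → ℕ → ℕ → Set where
    here  : ∀ {v σ} → At (v ∷ σ) 0 v
    there : ∀ {w v σ k} → At σ k v → At (w ∷ σ) (suc k) v

  split : ∀ {σ k v} → At σ k v → ∃ λ vs → ∃ λ ρ → σ ≡ vs ++ v ∷ ρ × k ≡ length vs
  split here = [] , _ , refl , refl
  split (there {w} p) with split p
  ... | vs , ρ , refl , refl = w ∷ vs , ρ , refl , refl

  opaque
    unfolding stack copy push0

    copy-run : ∀ {σ k v} → At σ k v → Runs (copy k) (stack σ) tt (stack (v ∷ σ))
    copy-run {v = v} p with split p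
    ... | vs , ρ , refl , refl =
      from-≡ (cong (λ z → ⟨ z ∣ emptySide ⟩ʳ) (enc-++ vs (v ∷ ρ) emptySide))
      (to-≡ (cong₂ (λ z x → ⟨ ones x (push blank z) ∣ emptySide ⟩ʳ)
        (trans (cong (λ x → enc vs (ones x _)) (+-identityʳ v)) (sym (enc-++ vs (v ∷ ρ) emptySide)))
        (+-identityʳ v))
      (oneʳ _ _ blank emptySide ⟫ turn-run _ emptySide ⟫ blocksˡ-run (0 ∷ vs) _ emptySide ⟫
       shuttle-run vs (enc ρ emptySide) v 0 0))

  encₛ : List ℕ → Side → Side
  encₛ [] r = r
  encₛ (y ∷ ys) r = encₛ ys (ones y (push blank r))

  -- A block of 1s moves one cell to the left by erasing its last 1 and turning its separator into a
  -- 1. The freed cell separates it from the block on its right, which has been shifted before.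
  shift : Mach ⊤
  shift = one (λ { blank → blank , L , false ; (just _) → blank , L , true }) >>ᵇ
          λ { false → ret tt ; true → blockˡ mark }

  shift-run : ∀ y l r → Runs shift ⟨ ones y (push blank l) ∣ r ⟩ˡ tt ⟨ l ∣ ones y (push blank r) ⟩ˡ
  shift-run zero l r = oneˡ _ l blank r ⟫ done
  shift-run (suc y) l r = oneˡ _ _ mark r ⟫ blockˡ-run mark y l _

  shifts-run : ∀ ys l r → Runs (times (length ys) shift) ⟨ enc ys l ∣ r ⟩ˡ tt ⟨ l ∣ encₛ ys r ⟩ˡ
  shifts-run [] l r = done
  shifts-run (y ∷ ys) l r = shift-run y _ r ⟫ shifts-run ys l _

  unshifts-run : ∀ y ys l r → Runs (blocksʳ (length ys))
    ⟨ push blank l ∣ encₛ (y ∷ ys) r ⟩ʳ tt ⟨ push blank (enc (y ∷ ys) l) ∣ r ⟩ʳ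
  unshifts-run y [] l r = blockʳ-run y _ r
  unshifts-run y (z ∷ ys) l r = unshifts-run z ys l _ ⟫ blockʳ-run y _ r

  -- Moves the topmost k + 1 numbers one cell to the left, over the last 1 of the number below them or,
  -- if that is 0, over its blank.
  shrink : ℕ → Mach (Maybe ⊤)
  shrink k = turn >> times (suc k) shift >> eat >>ᵇ λ b → blocksʳ k >> turn >> ret (verdict b)
    where
    verdict : Bool → Maybe ⊤
    verdict true = nothing
    verdict false = just tt

  opaque
    unfolding stack

    delAt : ℕ → Mach ⊤
    delAt k = loop (shrink k)

    delAt-enc : ∀ y ys z l → Runs (delAt (length ys))
      ⟨ enc (y ∷ ys) (ones z (push blank l)) ∣ emptySide ⟩ʳ tt ⟨ enc (y ∷ ys) l ∣ emptySide ⟩ʳ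
    delAt-enc y ys zero l = loop-done _
      (turn-run _ emptySide ⟫ shifts-run (y ∷ ys) _ emptySide ⟫ oneˡ _ _ blank _ ⟫
       unshifts-run y ys _ emptySide ⟫ turn-settle _ ⟫ done)
    delAt-enc y ys (suc z) l = loop-more _
      (turn-run _ emptySide ⟫ shifts-run (y ∷ ys) _ emptySide ⟫ oneˡ _ _ mark _ ⟫
       unshifts-run y ys _ emptySide ⟫ turn-settle _ ⟫ done)
      (delAt-enc y ys z l)

    delAt-run : ∀ y ys {z ρ} → Runs (delAt (length ys)) (stack (y ∷ ys ++ z ∷ ρ)) tt (stack (y ∷ ys ++ ρ))
    delAt-run y ys {z} {ρ} = from-≡ (cong (λ x → ⟨ x ∣ emptySide ⟩ʳ) (enc-++ (y ∷ ys) (z ∷ ρ) emptySide))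
      (to-≡ (cong (λ x → ⟨ x ∣ emptySide ⟩ʳ) (sym (enc-++ (y ∷ ys) ρ emptySide)))
        (delAt-enc y ys z (enc ρ emptySide)))

  dels-run : ∀ {m} y (ys : Vec ℕ m) σ → Runs (times m (delAt 0)) (stack (y ∷ toList ys ++ σ)) tt (stack (y ∷ σ))
  dels-run y [] σ = done
  dels-run y (z ∷ ys) σ = delAt-run y [] ⟫ dels-run y ys σ

  -- Compilation of recursive functions.

  -- When the step function starts, the stack holds, from the top, the incremented index, the
  -- iterations left, the old value and the old index; hence the depths 3 and 2 and the offset 4.
  recEnv : ∀ {n} → (Fin (suc n) → ℕ) → Fin (suc (suc n)) → ℕ
  recEnv env Fin.zero = 3
  recEnv env (Fin.suc Fin.zero) = 2
  recEnv env (Fin.suc (Fin.suc i)) = 4 + env (Fin.suc i)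

  minEnv : ∀ {n} → (Fin n → ℕ) → Fin (suc n) → ℕ
  minEnv env Fin.zero = 0
  minEnv env (Fin.suc i) = suc (env i)

  recBody : Mach ⊤ → Bool → Mach (Maybe ⊤)
  recBody g false = ret (just tt)
  recBody g true = delAt 2 >> copy 2 >> inc >> g >> delAt 2 >> delAt 2 >> ret nothing

  recLoop : Mach ⊤ → Mach ⊤
  recLoop g = loop (copy 2 >> dec >>ᵇ recBody g)

  minBody : Bool → Mach (Maybe ⊤)
  minBody false = ret (just tt)
  -- A nonzero value is not popped by one test; the candidate is copied above it, and the value and
  -- the old candidate are deleted.
  minBody true = copy 1 >> delAt 0 >> delAt 0 >> inc >> ret nothing

  minLoop : Mach ⊤ → Mach ⊤
  minLoop f = loop (f >> dec >>ᵇ minBody)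

  -- env gives the depth of each argument in the stack; the result is pushed, everything else is kept.
  -- The recursion loop keeps (value, index, iterations left) on top of the stack.
  comp : ∀ {n} → PR n → (Fin n → ℕ) → Mach ⊤
  comps : ∀ {m n} → Vec (PR n) m → (Fin n → ℕ) → Mach ⊤
  comp Zc env = push0
  comp Sc env = copy (env Fin.zero) >> inc
  comp (Pc i) env = copy (env i)
  comp (Cc {m} f gs) env = comps gs env >> comp f toℕ >> times m (delAt 0)
  comp (Rc f g) env =
    copy (env Fin.zero) >> push0 >>
    (comp f (λ i → 2 + env (Fin.suc i)) >> recLoop (comp g (recEnv env))) >> delAt 0 >> delAt 0
  comp (Mc f) env = push0 >> minLoop (comp f (minEnv env))
  comps [] env = ret tt
  comps {suc m} (g ∷ gs) env = comps gs env >> comp g (λ i → m + env i)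

  Args : ∀ {n} → List ℕ → (Fin n → ℕ) → Vec ℕ n → Set
  Args σ env xs = ∀ i → At σ (env i) (lookup xs i)

  at-skip : ∀ {m k v} (ys : Vec ℕ m) {σ} → At σ k v → At (toList ys ++ σ) (m + k) v
  at-skip [] p = p
  at-skip (_ ∷ ys) p = there (at-skip ys p)

  at-args : ∀ {m} (ys : Vec ℕ m) {σ} → Args (toList ys ++ σ) toℕ ys
  at-args (y ∷ ys) Fin.zero = here
  at-args (y ∷ ys) (Fin.suc i) = there (at-args ys i)

  comp-run : ∀ {n} {f : PR n} {xs y} → f [ xs ]⇓ y → ∀ {σ env} → Args σ env xs →
    Runs (comp f env) (stack σ) tt (stack (y ∷ σ))
  comps-run : ∀ {m n} {gs : Vec (PR n) m} {xs ys} → gs [ xs ]⇓* ys → ∀ {σ env} → Args σ env xs →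
    Runs (comps gs env) (stack σ) tt (stack (toList ys ++ σ))
  rec-run : ∀ {n} {f : PR n} {g k xs y} → Rc f g [ k ∷ xs ]⇓ y → ∀ {σ env} → Args σ env (k ∷ xs) →
    Runs (comp (Rc f g) env) (stack σ) tt (stack (y ∷ σ))
  -- The derivation descends from k to 0 while the machine counts up, hence the continuation form: a
  -- loop run from stage k with c iterations left is extended backwards, one iteration per `rS`, to
  -- a run from the start with k + c iterations left.
  climb : ∀ {n} {f : PR n} {g k xs y} → Rc f g [ k ∷ xs ]⇓ y → ∀ {σ env} →
    (∀ i → At σ (env (Fin.suc i)) (lookup xs i)) → ∀ c {t} →
    Runs (recLoop (comp g (recEnv env))) (stack (y ∷ k ∷ c ∷ σ)) tt t →
    Runs (comp f (λ i → 2 + env (Fin.suc i)) >> recLoop (comp g (recEnv env)))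
      (stack (0 ∷ k + c ∷ σ)) tt t
  search-run : ∀ {n} {f : PR (suc n)} {xs k y} → Search f xs k y → ∀ {σ env} → Args σ env xs →
    Runs (minLoop (comp f (minEnv env))) (stack (k ∷ σ)) tt (stack (y ∷ σ))

  comp-run zE A = push0-run _
  comp-run sE A = copy-run (A Fin.zero) ⟫ inc-run _ _
  comp-run pE A = copy-run (A _)
  comp-run (cE {ys = ys} p q) A = comps-run p A ⟫ comp-run q (at-args ys) ⟫ dels-run _ ys _
  comp-run r@(r0 _) A = rec-run r A
  comp-run r@(rS _ _) A = rec-run r A
  comp-run (mE s) A = push0-run _ ⟫ search-run s A
  comps-run [] A = done
  comps-run (_∷_ {ys = ys} p q) A = comps-run q A ⟫ comp-run p (λ i → at-skip ys (A i))
  rec-run {k = k} {y = y} r {σ} A =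
    copy-run (A Fin.zero) ⟫ push0-run _ ⟫
    from-≡ (cong (λ x → stack (0 ∷ x ∷ σ)) (sym (+-identityʳ k)))
      (climb r (λ i → A (Fin.suc i)) 0
        (loop-done _ (copy-run (there (there here)) ⟫ dec-zero _ ⟫ done))) ⟫
    delAt-run y [] ⟫ delAt-run y []
  climb (r0 p) A c r = comp-run p (λ i → there (there (A i))) ⟫ r
  climb {k = suc k} (rS {z = z} {y = y} p q) {σ} {env} A c r =
    from-≡ (cong (λ x → stack (0 ∷ x ∷ σ)) (sym (+-suc k c))) (climb p A (suc c) (loop-more _
      (copy-run (there (there here)) ⟫ dec-suc _ _ ⟫ delAt-run c (z ∷ k ∷ []) ⟫ copy-run (there (there here)) ⟫
       inc-run _ _ ⟫ comp-run q args ⟫ delAt-run y (suc k ∷ c ∷ []) ⟫ delAt-run y (suc k ∷ c ∷ []) ⟫ done)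
      r))
    where
    args : Args (suc k ∷ c ∷ z ∷ k ∷ σ) (recEnv env) (k ∷ z ∷ _)
    args Fin.zero = there (there (there here))
    args (Fin.suc Fin.zero) = there (there here)
    args (Fin.suc (Fin.suc i)) = there (there (there (there (A i))))
  search-run (found p) {σ} {env} A = loop-done _ (comp-run p args ⟫ dec-zero _ ⟫ done)
    where
    args : Args (_ ∷ σ) (minEnv env) (_ ∷ _)
    args Fin.zero = here
    args (Fin.suc i) = there (A i)
  search-run (next {k} p s) {σ} {env} A = loop-more _
    (comp-run p args ⟫ dec-suc _ _ ⟫ copy-run (there here) ⟫ delAt-run k [] ⟫ delAt-run k [] ⟫ inc-run _ _ ⟫ done)
    (search-run s A)
    where
    args : Args (_ ∷ σ) (minEnv env) (_ ∷ _)
    args Fin.zero = here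
    args (Fin.suc i) = there (A i)

  opaque
    unfolding stack

    stack-[] : stack [] ≡ (emptySide , □ , emptySide)
    stack-[] = refl

    move-stack : ∀ σ → move (stack σ) □ R ≡ stack (0 ∷ σ)
    move-stack σ = refl

  read : ∀ k → Mach (Fin (suc k))
  -- The number is known to be 0 here; the test is performed because it pops it.
  read zero = dec >>ᵇ λ _ → ret Fin.zero
  read (suc k) = dec >>ᵇ λ { false → ret Fin.zero ; true → bind finite-Fin (read k) (λ i → ret (Fin.suc i)) }

  read-run : ∀ k (i : Fin (suc k)) σ → Runs (read k) (stack (toℕ i ∷ σ)) i (stack σ)
  read-run zero Fin.zero σ = dec-zero σ ⟫ done
  read-run (suc k) Fin.zero σ = dec-zero σ ⟫ done
  read-run (suc k) (Fin.suc i) σ = dec-suc (toℕ i) σ ⟫ read-run k i σ ⟫ done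

  sense : ∀ {m} k → Vec (PR 1) m → Mach (Vec (Fin (suc k)) m)
  sense k [] = ret []
  sense {suc m} k (f ∷ fs) = comp f (λ _ → 0) >> bind finite-Fin (read k) λ i →
    bind (finite-Vec m finite-Fin) (sense k fs) λ is → ret (i ∷ is)

  sense-run : ∀ {m k x σ} (fs : Vec (PR 1) m) (is : Vec (Fin (suc k)) m) →
    (∀ j → lookup fs j [ x ∷ [] ]⇓ toℕ (lookup is j)) →
    Runs (sense k fs) (stack (x ∷ σ)) is (stack (x ∷ σ))
  sense-run [] [] _ = done
  sense-run (f ∷ fs) (i ∷ is) ok =
    comp-run (ok Fin.zero) (λ { Fin.zero → here }) ⟫ read-run _ i _ ⟫
    sense-run fs is (λ j → ok (Fin.suc j)) ⟫ done

  -- From a finite control to the rules of a reactive Turing machine.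

  module Flatten {nA : ℕ} (S : Set) (F : Finite S) (q₀ : S) (fin : S → Bool)
    (out : S → Sym → List (Act nA × Sym × Dir × S)) where

    Index : Set
    Index = Fin (length (F .elements))

    state : Index → S
    state = List.lookup (F .elements)

    index : S → Index
    index q = Any.index (F .complete q)

    -- `elements` may list a state several times, so only this composite is the identity; relations
    -- on configurations are therefore stated through `state`.
    state-index : ∀ q → state (index q) ≡ q
    state-index q = sym (lookup-index (F .complete q))

    Rule : Set
    Rule = Index × Sym × Act nA × Sym × Dir × Index

    rule : Index → Sym → Act nA × Sym × Dir × S → Rule
    rule i d (a , e , X , q) = i , d , a , e , X , index q

    syms : Finite Sym
    syms = finite-Maybe finite-Fin

    rulesFor : Index → List Rule
    rulesFor i = concatMap (λ d → map (rule i d) (out (state i) d)) (syms .elements)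

    M : RTM nA (suc nD)
    M = record
      { nS = length (F .elements)
      ; start = index q₀
      ; final = λ i → fin (state i)
      ; rules = concatMap rulesFor (allFin _)
      }

    ∈-rules⁺ : ∀ {i d x} → x ∈ out (state i) d → rule i d x ∈ RTM.rules M
    ∈-rules⁺ {i} {d} p = ∈-concatMap⁺ rulesFor (lose (∈-allFin i)
      (∈-concatMap⁺ (λ d → map (rule i d) (out (state i) d)) (lose (syms .complete d) (∈-map⁺ (rule i d) p))))

    ∈-rules⁻ : ∀ {i d a e X j} → (i , d , a , e , X , j) ∈ RTM.rules M →
      ∃ λ q → j ≡ index q × (a , e , X , q) ∈ out (state i) d
    ∈-rules⁻ p with find (∈-concatMap⁻ rulesFor {xs = allFin _} p)
    ... | i , _ , p′ with find (∈-concatMap⁻ (λ d → map (rule i d) (out (state i) d)) {xs = syms .elements} p′)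
    ...   | d , _ , p″ with ∈-map⁻ (rule i d) p″
    ...     | (_ , _ , _ , q) , q∈ , refl = q , refl , q∈

    fire : ∀ {i t a e X q} → (a , e , X , q) ∈ out (state i) (proj₁ (proj₂ t)) →
      Step M (i , t) a (index q , move t e X)
    fire {X = L} p = stepL (∈-rules⁺ p)
    fire {X = R} p = stepR (∈-rules⁺ p)

    fired : ∀ {i t a c} → Step M (i , t) a c →
      ∃ λ e → ∃ λ X → ∃ λ q → (a , e , X , q) ∈ out (state i) (proj₁ (proj₂ t)) × c ≡ (index q , move t e X)
    fired (stepL p) with ∈-rules⁻ p
    ... | q , refl , q∈ = _ , L , q , q∈ , refl
    fired (stepR p) with ∈-rules⁻ p
    ... | q , refl , q∈ = _ , R , q , q∈ , refl

-- Recursive functions and the decoding of lists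

-- Totality and correctness of `outF` supply separate derivations, whose values have to be
-- identified.
⇓-functional : ∀ {n} {f : PR n} {xs y z} → f [ xs ]⇓ y → f [ xs ]⇓ z → y ≡ z
⇓*-functional : ∀ {m n} {fs : Vec (PR n) m} {xs ys zs} → fs [ xs ]⇓* ys → fs [ xs ]⇓* zs → ys ≡ zs
search-functional : ∀ {n} {f : PR (suc n)} {xs k y z} → Search f xs k y → Search f xs k z → y ≡ z
⇓-functional zE zE = refl
⇓-functional sE sE = refl
⇓-functional pE pE = refl
⇓-functional (cE ps p) (cE qs q) with ⇓*-functional ps qs
... | refl = ⇓-functional p q
⇓-functional (r0 p) (r0 q) = ⇓-functional p q
⇓-functional (rS p p′) (rS q q′) with ⇓-functional p q
... | refl = ⇓-functional p′ q′
⇓-functional (mE p) (mE q) = search-functional p q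
⇓*-functional [] [] = refl
⇓*-functional (p ∷ ps) (q ∷ qs) = cong₂ _∷_ (⇓-functional p q) (⇓*-functional ps qs)
search-functional (found p) (found q) = refl
search-functional (found p) (next q _) with ⇓-functional p q
... | ()
search-functional (next p _) (found q) with ⇓-functional p q
... | ()
search-functional (next _ p) (next _ q) = search-functional p q

record Rec {n : ℕ} (f : Vec ℕ n → ℕ) : Set where
  constructor _by_
  field
    prog : PR n
    eval : ∀ xs → prog [ xs ]⇓ f xs
open Rec

record Rec₁ (f : ℕ → ℕ) : Set where
  constructor rec₁
  field un₁ : Rec {1} λ xs → f (lookup xs (# 0))
open Rec₁

record Rec₂ (f : ℕ → ℕ → ℕ) : Set where
  constructor rec₂
  field un₂ : Rec {2} λ xs → f (lookup xs (# 0)) (lookup xs (# 1))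

record Rec₃ (f : ℕ → ℕ → ℕ → ℕ) : Set where
  constructor rec₃
  field un₃ : Rec {3} λ xs → f (lookup xs (# 0)) (lookup xs (# 1)) (lookup xs (# 2))

module _ {n : ℕ} where

  var : (i : Fin n) → Rec λ xs → lookup xs i
  var i = Pc i by λ _ → pE

  const : ∀ c → Rec {n} λ _ → c
  const zero = Zc by λ _ → zE
  const (suc c) = Cc Sc (const c .prog ∷ []) by λ xs → cE (const c .eval xs ∷ []) sE

  app₁ : ∀ {f} {g : Vec ℕ n → ℕ} → Rec₁ f → Rec g → Rec λ xs → f (g xs)
  app₁ (rec₁ F) G = Cc (F .prog) (G .prog ∷ []) by λ xs → cE (G .eval xs ∷ []) (F .eval _)

  app₂ : ∀ {f} {g h : Vec ℕ n → ℕ} → Rec₂ f → Rec g → Rec h → Rec λ xs → f (g xs) (h xs)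
  app₂ (rec₂ F) G H =
    Cc (F .prog) (G .prog ∷ H .prog ∷ []) by λ xs → cE (G .eval xs ∷ H .eval xs ∷ []) (F .eval _)

  app₃ : ∀ {f} {g h k : Vec ℕ n → ℕ} → Rec₃ f → Rec g → Rec h → Rec k →
         Rec λ xs → f (g xs) (h xs) (k xs)
  app₃ (rec₃ F) G H K = Cc (F .prog) (G .prog ∷ H .prog ∷ K .prog ∷ []) by
    λ xs → cE (G .eval xs ∷ H .eval xs ∷ K .eval xs ∷ []) (F .eval _)

  primrec : ∀ {f g} (h : ℕ → Vec ℕ n → ℕ) → Rec f → Rec g →
            (∀ xs → h 0 xs ≡ f xs) → (∀ k xs → h (suc k) xs ≡ g (k ∷ h k xs ∷ xs)) →
            Rec λ xs → h (head xs) (tail xs)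
  primrec h F G base ind = Rc (F .prog) (G .prog) by λ { (k ∷ xs) → go k xs }
    where
    go : ∀ k xs → Rc (F .prog) (G .prog) [ k ∷ xs ]⇓ h k xs
    go zero xs = subst (Rc _ _ [ 0 ∷ xs ]⇓_) (sym (base xs)) (r0 (F .eval xs))
    go (suc k) xs = subst (Rc _ _ [ suc k ∷ xs ]⇓_) (sym (ind k xs)) (rS (go k xs) (G .eval _))

ext : ∀ {n} {f g : Vec ℕ n → ℕ} → (∀ xs → f xs ≡ g xs) → Rec f → Rec g
ext f≗g F = F .prog by λ xs → subst (F .prog [ xs ]⇓_) (f≗g xs) (F .eval xs)

suc-rec : Rec₁ suc
suc-rec = rec₁ (Sc by λ { (x ∷ []) → sE })

pred-rec : Rec₁ pred
pred-rec = rec₁ (ext (λ { (x ∷ []) → refl })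
  (primrec (λ k _ → pred k) (const 0) (var (# 0)) (λ _ → refl) (λ _ _ → refl)))

+-rec : Rec₂ _+_
+-rec = rec₂ (ext (λ { (x ∷ y ∷ []) → refl })
  (primrec (λ k xs → k + lookup xs (# 0)) (var (# 0)) (app₁ suc-rec (var (# 1))) (λ _ → refl) (λ _ _ → refl)))

∸-rec : Rec₂ _∸_
∸-rec = rec₂ (app₂ flipped (var (# 1)) (var (# 0)))
  where
  flipped : Rec₂ λ k x → x ∸ k
  flipped = rec₂ (ext (λ { (x ∷ y ∷ []) → refl })
    (primrec (λ k xs → lookup xs (# 0) ∸ k) (var (# 0)) (app₁ pred-rec (var (# 1)))
      (λ _ → refl) (λ k xs → sym (pred[m∸n]≡m∸[1+n] (lookup xs (# 0)) k))))

-- Applied to a truncated difference a ∸ b, this branches on a ≤ b.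
ifz : ℕ → ℕ → ℕ → ℕ
ifz zero a b = a
ifz (suc _) a b = b

ifz-rec : Rec₃ ifz
ifz-rec = rec₃ (ext (λ { (x ∷ y ∷ z ∷ []) → refl })
  (primrec (λ k xs → ifz k (lookup xs (# 0)) (lookup xs (# 1))) (var (# 0)) (var (# 3))
    (λ _ → refl) (λ { _ (_ ∷ _ ∷ []) → refl })))

tri-rec : Rec₁ tri
tri-rec = rec₁ (ext (λ { (x ∷ []) → refl })
  (primrec (λ k _ → tri k) (const 0) (app₂ +-rec (app₁ suc-rec (var (# 0))) (var (# 1)))
    (λ _ → refl) (λ _ _ → refl)))

-- The largest w with tri w ≤ z, which is x + y for z = pair x y.
root : ℕ → ℕ
root zero = 0
root (suc z) = ifz (tri (suc (root z)) ∸ suc z) (suc (root z)) (root z)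

root-rec : Rec₁ root
root-rec = rec₁ (ext (λ { (x ∷ []) → refl })
  (primrec (λ k _ → root k) (const 0)
    (app₃ ifz-rec
      (app₂ ∸-rec (app₁ tri-rec (app₁ suc-rec (var (# 1)))) (app₁ suc-rec (var (# 0))))
      (app₁ suc-rec (var (# 1))) (var (# 1)))
    (λ _ → refl) (λ _ _ → refl)))

-- One increment per step suffices, because `tri (suc w)` and `tri (suc (suc w))` are at least 1
-- apart.
root-bounds : ∀ z → tri (root z) ≤ z × z < tri (suc (root z))
root-bounds zero = z≤n , s≤s z≤n
root-bounds (suc z) with root-bounds z | tri (suc (root z)) ∸ suc z in eq
... | lo , hi | zero = m∸n≡0⇒m≤n eq , s≤s (≤-trans hi (m≤n+m _ (suc (root z))))
... | lo , hi | suc d =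
  m≤n⇒m≤1+n lo , ≰⇒> λ le → contradiction (trans (sym (m≤n⇒m∸n≡0 le)) eq) λ ()

tri-mono : ∀ {m n} → m ≤ n → tri m ≤ tri n
tri-mono z≤n = z≤n
tri-mono (s≤s m≤n) = +-mono-≤ (s≤s m≤n) (tri-mono m≤n)

root-unique : ∀ {w z} → tri w ≤ z → z < tri (suc w) → root z ≡ w
root-unique {w} {z} lo hi with root-bounds z
... | lo′ , hi′ = ≤-antisym (≮⇒≥ (apart lo′ hi)) (≮⇒≥ (apart lo hi′))
  where
  apart : ∀ {v v′} → tri v ≤ z → z < tri (suc v′) → v′ < v → _
  apart lo hi v′<v = <⇒≱ hi (≤-trans (tri-mono v′<v) lo)

root-pair : ∀ x y → root (pair x y) ≡ x + y
root-pair x y = root-unique (m≤m+n (tri (x + y)) y)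
  (s≤s (subst (_≤ x + y + tri (x + y)) (+-comm y _) (+-monoˡ-≤ (tri (x + y)) (m≤n+m y x))))

sndN fstN : ℕ → ℕ
sndN z = z ∸ tri (root z)
fstN z = root z ∸ sndN z

sndN-rec : Rec₁ sndN
sndN-rec = rec₁ (app₂ ∸-rec (var (# 0)) (app₁ tri-rec (app₁ root-rec (var (# 0)))))

fstN-rec : Rec₁ fstN
fstN-rec = rec₁ (app₂ ∸-rec (app₁ root-rec (var (# 0))) (app₁ sndN-rec (var (# 0))))

sndN-pair : ∀ x y → sndN (pair x y) ≡ y
sndN-pair x y rewrite root-pair x y = m+n∸m≡n (tri (x + y)) y

fstN-pair : ∀ x y → fstN (pair x y) ≡ x
fstN-pair x y rewrite sndN-pair x y | root-pair x y = m+n∸n≡m x y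

n≤tri : ∀ n → n ≤ tri n
n≤tri zero = z≤n
n≤tri (suc n) = m≤m+n (suc n) (tri n)

fst≤pair : ∀ x y → x ≤ pair x y
fst≤pair x y = ≤-trans (m≤m+n x y) (≤-trans (n≤tri (x + y)) (m≤m+n _ y))

snd≤pair : ∀ x y → y ≤ pair x y
snd≤pair x y = m≤n+m y (tri (x + y))

-- Makes `suc t` a valid start for `chain`, above every h + 1.
∈⇒<listCode : ∀ {h l} → h ∈ l → h < listCode l
∈⇒<listCode {l = x ∷ l} (here refl) = s≤s (fst≤pair x _)
∈⇒<listCode {l = x ∷ l} (there p) = s≤s (≤-trans (<⇒≤ (∈⇒<listCode p)) (snd≤pair x _))

-- Lets `below` use the code t itself as the number of positions to scan.
length≤listCode : ∀ l → length l ≤ listCode l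
length≤listCode [] = z≤n
length≤listCode (x ∷ l) = s≤s (≤-trans (length≤listCode l) (snd≤pair x _))

hd tl : ℕ → ℕ
hd t = fstN (pred t)
tl t = sndN (pred t)

dropN : ℕ → ℕ → ℕ
dropN zero t = t
dropN (suc k) t = tl (dropN k t)

dropN-rec : Rec₂ dropN
dropN-rec = rec₂ (ext (λ { (x ∷ y ∷ []) → refl })
  (primrec (λ k xs → dropN k (lookup xs (# 0))) (var (# 0)) (app₁ sndN-rec (app₁ pred-rec (var (# 1))))
    (λ _ → refl) (λ _ _ → refl)))

-- 2 + h ∸ u vanishes iff h + 1 < u, and acc + (h + 1 ∸ acc) is a maximum.
pick : ℕ → ℕ → ℕ → ℕ
pick u t acc = ifz t acc (ifz (2 + hd t ∸ u) (acc + (suc (hd t) ∸ acc)) acc)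

pick-rec : Rec₃ pick
pick-rec = rec₃ (app₃ ifz-rec (var (# 1)) (var (# 2))
  (app₃ ifz-rec (app₂ ∸-rec (app₁ suc-rec hd⁺) (var (# 0)))
    (app₂ +-rec (var (# 2)) (app₂ ∸-rec hd⁺ (var (# 2)))) (var (# 2))))
  where
  hd⁺ : Rec {3} _
  hd⁺ = app₁ suc-rec (app₁ fstN-rec (app₁ pred-rec (var (# 1))))

scan : ℕ → ℕ → ℕ → ℕ
scan zero u t = 0
scan (suc k) u t = pick u (dropN k t) (scan k u t)

scan-rec : Rec₃ scan
scan-rec = rec₃ (ext (λ { (x ∷ y ∷ z ∷ []) → refl })
  (primrec (λ k xs → scan k (lookup xs (# 0)) (lookup xs (# 1))) (const 0)
    (app₃ pick-rec (var (# 2)) (app₂ dropN-rec (var (# 0)) (var (# 3))) (var (# 1)))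
    (λ _ → refl) (λ { _ (_ ∷ _ ∷ []) → refl })))

-- The largest h + 1 below u with h in the list coded by t, and 0 if there is none. Iterating it lists
-- the members without repetition.
below : ℕ → ℕ → ℕ
below u t = scan t u t

chain : ℕ → ℕ → ℕ
chain zero t = suc t
chain (suc j) t = below (chain j t) t

chain-rec : ∀ j → Rec₁ (chain j)
chain-rec zero = suc-rec
chain-rec (suc j) = rec₁ (app₃ scan-rec (var (# 0)) (app₁ (chain-rec j) (var (# 0))) (var (# 0)))

pick-cons : ∀ u x c acc → let t = suc (pair x c) in
  (pick u t acc ≡ suc x × suc x < u) ⊎ pick u t acc ≡ acc
pick-cons u x c acc rewrite fstN-pair x c with 2 + x ∸ u in eq
... | suc _ = inj₂ refl
... | zero with ≤-total (suc x) acc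
...   | inj₁ x<acc rewrite m≤n⇒m∸n≡0 x<acc = inj₂ (+-identityʳ acc)
...   | inj₂ acc≤x = inj₁ (m+[n∸m]≡n acc≤x , m∸n≡0⇒m≤n eq)

pick-≥acc : ∀ u t acc → acc ≤ pick u t acc
pick-≥acc u zero acc = ≤-refl
pick-≥acc u t@(suc _) acc with 2 + hd t ∸ u
... | zero = m≤m+n acc _
... | suc _ = ≤-refl

pick-≥hd : ∀ u x c acc → suc x < u → suc x ≤ pick u (suc (pair x c)) acc
pick-≥hd u x c acc x<u rewrite fstN-pair x c | m≤n⇒m∸n≡0 x<u = m≤n+m∸n (suc x) acc

tl-cons : ∀ x l → tl (listCode (x ∷ l)) ≡ listCode l
tl-cons x l = sndN-pair x (listCode l)

dropN-suffix : ∀ l k → ∃ λ l′ → dropN k (listCode l) ≡ listCode l′ × (∀ {h} → h ∈ l′ → h ∈ l)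
dropN-suffix l zero = l , refl , λ p → p
dropN-suffix l (suc k) with dropN-suffix l k
-- `tl` sends 0, the code of the empty list, to itself.
... | [] , eq , sub = [] , cong tl eq , sub
... | x ∷ l′ , eq , sub = l′ , trans (cong tl eq) (tl-cons x l′) , λ p → sub (there p)

scan-sound : ∀ u l k →
  scan k u (listCode l) ≡ 0 ⊎ ∃ λ h → h ∈ l × scan k u (listCode l) ≡ suc h × suc h < u
scan-sound u l zero = inj₁ refl
scan-sound u l (suc k) with dropN-suffix l k
... | [] , eq , _ rewrite eq = scan-sound u l k
... | x ∷ l′ , eq , sub rewrite eq with pick-cons u x (listCode l′) (scan k u (listCode l))
...   | inj₁ (e , x<u) = inj₂ (x , sub (here refl) , e , x<u)
...   | inj₂ e rewrite e = scan-sound u l k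

scan-mono : ∀ u t {m n} → m ≤′ n → scan m u t ≤ scan n u t
scan-mono u t ≤′-refl = ≤-refl
scan-mono u t (≤′-step {n} p) = ≤-trans (scan-mono u t p) (pick-≥acc u (dropN n t) (scan n u t))

-- The offset k advances along the list until h is the head of the suffix `l′`. The pick made there
-- is at least h + 1, and no later pick lowers the accumulator.
scan-complete : ∀ {u t h l′} k n → dropN k t ≡ listCode l′ → h ∈ l′ → suc h < u →
  k + length l′ ≤ n → suc h ≤ scan n u t
scan-complete {u} {t} {h} {_ ∷ l′} k n eq (here refl) h<u le = ≤-trans
  (subst (λ c → suc h ≤ pick u c (scan k u t)) (sym eq) (pick-≥hd u h (listCode l′) (scan k u t) h<u))
  (scan-mono u t (≤⇒≤′ (≤-trans (≤-trans (s≤s (m≤m+n k _)) (≤-reflexive (sym (+-suc k _)))) le)))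
scan-complete {l′ = x ∷ l′} k n eq (there p) h<u le =
  scan-complete (suc k) n (trans (cong tl eq) (tl-cons x l′)) p h<u (≤-trans (≤-reflexive (sym (+-suc k _))) le)

-- Completeness of the enumeration of edges.

module _ {nA : ℕ} (𝑻 : TS nA) where
  open TS 𝑻

  edgeCode : (State → ℕ) → Act nA × State → ℕ
  edgeCode code (a , t) = pair (codeAct a) (code t)

  module _ (code : State → ℕ) (s : State) {B : ℕ}
    (bound : ∀ (es : List (Act nA × State)) → Unique es →
      All (λ e → s ⟶[ proj₁ e ] proj₂ e) es → length es ≤ B)
    {l : List ℕ} (sound : ∀ {m} → m ∈ l → ∃ λ a → ∃ λ t → s ⟶[ a ] t × m ≡ edgeCode code (a , t)) where

    -- As long as h has not been listed, the j members listed so far come from j distinct edges, all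
    -- different from that of h; so this must end before j = B.
    Pending : ℕ → ℕ → Set
    Pending h j = suc h < chain j (listCode l) × ∃ λ es → length es ≡ j × Unique es ×
      All (λ e → s ⟶[ proj₁ e ] proj₂ e) es × All (λ e → chain j (listCode l) ≤ suc (edgeCode code e)) es

    -- The new edge differs from all old ones because its code lies strictly below theirs.
    extend : ∀ {m u j es a t} → m < u → s ⟶[ a ] t → m ≡ edgeCode code (a , t) → length es ≡ j →
      Unique es → All (λ e → s ⟶[ proj₁ e ] proj₂ e) es → All (λ e → u ≤ edgeCode code e) es →
      length ((a , t) ∷ es) ≡ suc j × Unique ((a , t) ∷ es) ×
      All (λ e → s ⟶[ proj₁ e ] proj₂ e) ((a , t) ∷ es) × All (λ e → m ≤ edgeCode code e) ((a , t) ∷ es)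
    extend m<u st refl len un tr ge =
      cong suc len ,
      All.map (λ u≤e → λ { refl → <⇒≱ m<u u≤e }) ge ∷ un ,
      st ∷ tr ,
      ≤-refl ∷ All.map (λ u≤e → ≤-trans (<⇒≤ m<u) u≤e) ge

    pending-step : ∀ {h} → h ∈ l → ∀ j → Pending h j →
      chain (suc j) (listCode l) ≡ suc h ⊎ Pending h (suc j)
    pending-step {h} h∈l j (h<c , es , len , un , tr , ge)
      -- The next maximum is at least h + 1: equality lists h, strictness keeps it pending.
      with m≤n⇒m<n∨m≡n (scan-complete 0 (listCode l) refl h∈l h<c (length≤listCode l))
    ... | inj₂ eq = inj₁ (sym eq)
    ... | inj₁ h<c′ with scan-sound (chain j (listCode l)) l (listCode l)
    ...   | inj₁ c′≡0 = contradiction (subst (suc h <_) c′≡0 h<c′) λ ()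
    ...   | inj₂ (m , m∈l , c′≡m , m<c) with sound m∈l
    ...     | a , t , st , eq with extend (s≤s (≤-refl {m})) st eq len un tr
                                    (All.map (λ c≤e → s≤s⁻¹ (≤-trans m<c c≤e)) ge)
    ...       | len′ , un′ , tr′ , ge′ = inj₂ (h<c′ , (a , t) ∷ es , len′ , un′ , tr′ ,
      All.map (λ m≤e → ≤-trans (≤-reflexive c′≡m) (s≤s m≤e)) ge′)

    search-chain : ∀ {h} → h ∈ l → ∀ j →
      (∃ λ i → i < j × chain (suc i) (listCode l) ≡ suc h) ⊎ Pending h j
    search-chain h∈l zero = inj₂ (s≤s (∈⇒<listCode h∈l) , [] , refl , [] , [] , [])
    search-chain h∈l (suc j) with search-chain h∈l j
    ... | inj₁ (i , i<j , eq) = inj₁ (i , m≤n⇒m≤1+n i<j , eq)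
    ... | inj₂ p with pending-step h∈l j p
    ...   | inj₁ eq = inj₁ (j , ≤-refl , eq)
    ...   | inj₂ p′ = inj₂ p′

    chain-complete : ∀ {h} → h ∈ l → ∃ λ i → i < B × chain (suc i) (listCode l) ≡ suc h
    chain-complete h∈l with search-chain h∈l B
    ... | inj₁ r = r
    ... | inj₂ (h<c , es , len , un , tr , ge) with sound h∈l
    -- If h were still pending at j = B, its own edge would be one more, giving B + 1 distinct edges
    -- out of s.
    ...   | a , t , st , eq with extend (≤-refl) st eq len un tr
                                    (All.map (λ c≤e → s≤s⁻¹ (≤-trans h<c c≤e)) ge)
    ...     | len′ , un′ , tr′ , _ =
      contradiction (≤-trans (≤-reflexive (sym len′)) (bound _ un′ tr′)) (<⇒≱ ≤-refl)

-- The machine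

module _ {nA : ℕ} where

  -- Labels are `codeAct` shifted by one: 0 stays free for an absent edge and τ becomes 1.
  label : Fin (suc (suc nA)) → Maybe (Act nA)
  label Fin.zero = nothing
  label (Fin.suc i) = just (un i)
    where
    un : Fin (suc nA) → Act nA
    un Fin.zero = nothing
    un (Fin.suc i) = just i

  unlabel : Act nA → Fin (suc (suc nA))
  unlabel nothing = Fin.suc Fin.zero
  unlabel (just a) = Fin.suc (Fin.suc a)

  label-unlabel : ∀ a → label (unlabel a) ≡ just a
  label-unlabel nothing = refl
  label-unlabel (just a) = refl

  toℕ-unlabel : ∀ a → toℕ (unlabel a) ≡ suc (codeAct a)
  toℕ-unlabel nothing = refl
  toℕ-unlabel (just a) = refl

-- Component 0 of a view is the finality of the state; component j + 1 is the label of its j-th edge,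
-- with 0 for no edge. The senses compute the view and target j the end point of the j-th edge.
record Simulator {nA : ℕ} (𝑻 : TS nA) : Set where
  open TS 𝑻
  field
    code   : State → ℕ
    B      : ℕ
    senses : Vec (PR 1) (suc B)
    target : Fin B → PR 1
    view   : State → Vec (Fin (suc (suc nA))) (suc B)
    senses-view : ∀ s j → lookup senses j [ code s ∷ [] ]⇓ toℕ (lookup (view s) j)
    final⇒  : ∀ s → Final s → head (view s) ≡ Fin.suc Fin.zero
    final⇐  : ∀ s {i} → head (view s) ≡ Fin.suc i → Final s
    edge⇒   : ∀ {s a t} → s ⟶[ a ] t →
      ∃ λ j → label (lookup (view s) (Fin.suc j)) ≡ just a × target j [ code s ∷ [] ]⇓ code t
    edge⇐   : ∀ s j {a} → label (lookup (view s) (Fin.suc j)) ≡ just a →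
      ∃ λ t → s ⟶[ a ] t × target j [ code s ∷ [] ]⇓ code t

module _ (nD : ℕ) {nA : ℕ} (𝑻 : TS nA) (sim : Simulator 𝑻) where
  open TS 𝑻
  open Simulator sim
  open Tape (suc nD)
  open Machines nD

  View : Set
  View = Vec (Fin (suc (suc nA))) (suc B)

  phase : Maybe (Fin B) → Mach View
  phase nothing = comp {0} (const (code init) .prog) (λ ()) >> sense (suc nA) senses
  -- The source code is at depth 1, under the 0 pushed by the move; the two deletions remove that 0
  -- and the source code from beneath the result.
  phase (just j) = comp (target j) (λ _ → 1) >> delAt 0 >> delAt 0 >> sense (suc nA) senses

  boot-run : Runs (phase nothing) (stack []) (view init) (stack (code init ∷ []))
  boot-run = comp-run (const (code init) .eval []) (λ ()) ⟫ sense-run senses (view init) (senses-view init)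

  -- The move out of a choice configuration goes right and thereby pushes a 0.
  jump-run : ∀ {s t j} → target j [ code s ∷ [] ]⇓ code t →
    Runs (phase (just j)) (stack (0 ∷ code s ∷ [])) (view t) (stack (code t ∷ []))
  jump-run {t = t} p = comp-run p (λ { Fin.zero → there here }) ⟫ delAt-run _ [] ⟫ delAt-run _ [] ⟫
    sense-run senses (view t) (senses-view t)

  Ctl : Set
  Ctl = Σ (Maybe (Fin B)) (λ p → Q (phase p)) ⊎ View

  ctl : ∀ p → Q (phase p) ⊎ View → Ctl
  ctl p (inj₁ q) = inj₁ (p , q)
  ctl p (inj₂ v) = inj₂ v

  -- Inner states may be non-final throughout: finality of s can be matched after τ-steps, at the
  -- choice configuration.
  finalCtl : Ctl → Bool
  finalCtl (inj₁ _) = false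
  finalCtl (inj₂ (Fin.zero ∷ _)) = false
  finalCtl (inj₂ (Fin.suc _ ∷ _)) = true

  offer : Fin B → Maybe (Act nA) → List (Act nA × Sym × Dir × Ctl)
  offer j nothing = []
  offer j (just a) = (a , □ , R , ctl (just j) (entry (phase (just j)))) ∷ []

  out : Ctl → Sym → List (Act nA × Sym × Dir × Ctl)
  out (inj₁ (p , q)) d = let (e , X , n) = δ (phase p) q d in (τ , e , X , ctl p n) ∷ []
  out (inj₂ v) d = concatMap (λ j → offer j (label (lookup v (Fin.suc j)))) (allFin B)

  finite-Ctl : Finite Ctl
  finite-Ctl = finite-⊎ (finite-Σ (finite-Maybe finite-Fin) (λ p → finite (phase p))) (finite-Vec _ finite-Fin)

  open Flatten Ctl finite-Ctl (ctl nothing (entry (phase nothing))) finalCtl out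

  ∈-offer⁺ : ∀ v j d {a} → label (lookup v (Fin.suc j)) ≡ just a →
    (a , □ , R , ctl (just j) (entry (phase (just j)))) ∈ out (inj₂ v) d
  ∈-offer⁺ v j d eq = ∈-concatMap⁺ (λ j → offer j (label (lookup v (Fin.suc j)))) (lose (∈-allFin j)
    (subst (λ x → _ ∈ offer j x) (sym eq) (here refl)))

  ∈-offer⁻ : ∀ v d {a e X q} → (a , e , X , q) ∈ out (inj₂ v) d →
    ∃ λ j → label (lookup v (Fin.suc j)) ≡ just a ×
      (e , X , q) ≡ (□ , R , ctl (just j) (entry (phase (just j))))
  ∈-offer⁻ v d p with find (∈-concatMap⁻ (λ j → offer j (label (lookup v (Fin.suc j)))) {xs = allFin B} p)
  ... | j , _ , p′ with label (lookup v (Fin.suc j)) in eq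
  ...   | just _ with here refl ← p′ = j , eq , refl

  -- The branching bisimulation.

  -- A derivation is a finite run, so induction on it both reaches the choice configuration and
  -- excludes divergence on the way. Right after a move the configuration belongs to the target, not
  -- to the source.
  data Rel (s : State) : Ctl → Tp → Set where
    choice : Rel s (inj₂ (view s)) (stack (code s ∷ []))
    inner  : ∀ {p q t} → (let (e , X , n) = δ (phase p) q (proj₁ (proj₂ t))) →
             Rel s (ctl p n) (move t e X) → Rel s (inj₁ (p , q)) t

  run⇒Rel : ∀ {s p x t} → Run (phase p) x t (view s) (stack (code s ∷ [])) → Rel s (ctl p x) t
  run⇒Rel exit = choice
  run⇒Rel (step r) = inner (run⇒Rel r)

  𝓡 : State → Config M → Set
  𝓡 s (i , t) = Rel s (state i) t

  at-index : ∀ {s q t} → Rel s q t → 𝓡 s (index q , t)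
  at-index = subst (λ q → Rel _ q _) (sym (state-index _))

  inner-step : ∀ {i t p q a c} → state i ≡ inj₁ (p , q) → Step M (i , t) a c →
    let (e , X , n) = δ (phase p) q (proj₁ (proj₂ t)) in a ≡ τ × c ≡ (index (ctl p n) , move t e X)
  inner-step {i} eq st with fired st
  ... | _ , _ , _ , x∈ , refl rewrite eq with here refl ← x∈ = refl , refl

  choice-step⁻ : ∀ {i s a c} → state i ≡ inj₂ (view s) → Step M (i , stack (code s ∷ [])) a c →
    ∃ λ t → s ⟶[ a ] t × 𝓡 t c
  choice-step⁻ {i} {s} eq st with fired st
  ... | _ , _ , _ , x∈ , refl rewrite eq with ∈-offer⁻ (view s) (proj₁ (proj₂ (stack (code s ∷ [])))) x∈
  ...   | j , lab , refl with edge⇐ s j lab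
  ...     | t , s⟶t , ev = t , s⟶t ,
    at-index (subst (Rel t _) (sym (move-stack _)) (run⇒Rel {p = just j} (run (jump-run ev))))

  choice-step⁺ : ∀ {i s a t} → state i ≡ inj₂ (view s) → s ⟶[ a ] t →
    ∃ λ c → Step M (i , stack (code s ∷ [])) a c × 𝓡 t c
  choice-step⁺ {i} {s} {a} {t} eq s⟶t with edge⇒ s⟶t
  ... | j , lab , ev = _ ,
    fire (subst (λ q → (a , □ , R , ctl (just j) (entry (phase (just j)))) ∈ out q _) (sym eq)
      (∈-offer⁺ (view s) j (proj₁ (proj₂ (stack (code s ∷ [])))) lab)) ,
    at-index (subst (Rel t _) (sym (move-stack _)) (run⇒Rel {p = just j} (run (jump-run ev))))

  settles : ∀ {s q t} → Rel s q t → ∀ {i} → state i ≡ q →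
    ∃ λ i′ → _↠_ (𝒯 M) (i , t) (i′ , stack (code s ∷ [])) × state i′ ≡ inj₂ (view s)
  settles choice eq = _ , ε , eq
  settles (inner r) {i} eq with settles r (state-index _)
  ... | i′ , steps , eq′ = i′ , fire (subst (λ q → _ ∈ out q _) (sym eq) (here refl)) ◅ steps , eq′

  at-choice : ∀ {i s} → state i ≡ inj₂ (view s) → 𝓡 s (i , stack (code s ∷ []))
  at-choice eq = subst (λ q → Rel _ q _) (sym eq) choice

  append-step : ∀ {x y z} → _↠_ (𝒯 M) x y → Step M y τ z → _↠⁺_ (𝒯 M) x z
  append-step ε st = _ , st , ε
  append-step (st′ ◅ sts) st with append-step sts st
  ... | _ , st″ , sts′ = _ , st′ , st″ ◅ sts′

  final-choice : ∀ s → Final s → T (finalCtl (inj₂ (view s)))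
  final-choice s F with view s | final⇒ s F
  ... | _ ∷ _ | refl = tt

  final-Rel : ∀ {s q t} → Rel s q t → T (finalCtl q) → Final s
  final-Rel {s} choice F with view s | final⇐ s
  ... | Fin.suc _ ∷ _ | f = f refl

  forth : OneSided 𝑻 (𝒯 M) 𝓡
  forth = transfer , finals , diverge
    where
    transfer : ∀ {s c a s′} → 𝓡 s c → s ⟶[ a ] s′ → ∃ λ c″ → ∃ λ c′ →
      _↠_ (𝒯 M) c c″ × _⟶⟨_⟩_ (𝒯 M) c″ a c′ × 𝓡 s c″ × 𝓡 s′ c′
    transfer r st with settles r refl
    ... | _ , sts , eq with choice-step⁺ eq st
    ...   | c′ , st′ , r′ = _ , c′ , sts , inj₁ st′ , at-choice eq , r′
    finals : ∀ {s c} → 𝓡 s c → Final s → ∃ λ c′ → _↠_ (𝒯 M) c c′ × TS.Final (𝒯 M) c′ × 𝓡 s c′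
    finals {s} r F with settles r refl
    ... | _ , sts , eq =
      _ , sts , subst (λ q → T (finalCtl q)) (sym eq) (final-choice s F) , at-choice eq
    diverge : ∀ {s c} → 𝓡 s c → (f : ℕ → State) → f 0 ≡ s → (∀ i → f i ⟶[ τ ] f (suc i)) →
      (∀ i → 𝓡 (f i) c) → ∃ λ c′ → _↠⁺_ (𝒯 M) c c′ × ∃ λ i → 𝓡 (f i) c′
    -- A single step of the divergence is enough: settling and then matching `st 0` is a nonempty
    -- τ-run ending in a configuration related to `f 1`.
    diverge _ f _ st rs with settles (rs 0) refl
    ... | _ , sts , eq with choice-step⁺ eq (st 0)
    ...   | c′ , st′ , r′ = c′ , append-step sts st′ , 1 , r′

  back : OneSided (𝒯 M) 𝑻 (λ c s → 𝓡 s c)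
  back = transfer , (λ r F → _ , ε , final-Rel r F , r) , λ _ f _ st rs → diverge f st 0 (rs 0) refl
    where
    transfer : ∀ {c s a c′} → 𝓡 s c → Step M c a c′ → ∃ λ s″ → ∃ λ s′ →
      _↠_ 𝑻 s s″ × _⟶⟨_⟩_ 𝑻 s″ a s′ × 𝓡 s″ c × 𝓡 s′ c′
    transfer r st = go r refl r st
      where
      go : ∀ {s q i t a c′} → Rel s q t → state i ≡ q → 𝓡 s (i , t) → Step M (i , t) a c′ → ∃ λ s″ → ∃ λ s′ →
        _↠_ 𝑻 s s″ × _⟶⟨_⟩_ 𝑻 s″ a s′ × 𝓡 s″ (i , t) × 𝓡 s′ c′
      go {s} choice eq r st with choice-step⁻ {s = s} eq st
      ... | s′ , st′ , r′ = s , s′ , ε , inj₁ st′ , r , r′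
      go {s} (inner r₁) eq r st with inner-step eq st
      ... | refl , refl = s , s , ε , inj₂ (refl , refl) , r , at-index r₁
    -- The derivation of `Rel` bounds the inner steps, so the run arrives at the choice
    -- configuration at some index n; its step there comes from a genuine τ-move of s.
    diverge : ∀ {s} (f : ℕ → Config M) → (∀ n → Step M (f n) τ (f (suc n))) →
      ∀ n {q t} → Rel s q t → (state (proj₁ (f n)) , proj₂ (f n)) ≡ (q , t) →
      ∃ λ s′ → _↠⁺_ 𝑻 s s′ × ∃ λ i → 𝓡 s′ (f i)
    diverge {s} f st n choice eq
      with choice-step⁻ {s = s} (cong proj₁ eq) (subst (λ t → Step M (_ , t) τ _) (cong proj₂ eq) (st n))
    ... | s′ , st′ , r′ = s′ , (s′ , st′ , ε) , suc n , r′
    diverge f st n (inner {p} {q} {t} r) eq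
      with inner-step (cong proj₁ eq) (subst (λ t → Step M (_ , t) τ _) (cong proj₂ eq) (st n))
    ... | _ , eq′ = diverge f st (suc n) r
      (trans (cong (λ c → state (proj₁ c) , proj₂ c) eq′) (cong (_, move t e X) (state-index _)))
      where
      e = proj₁ (δ (phase p) q (proj₁ (proj₂ t)))
      X = proj₁ (proj₂ (δ (phase p) q (proj₁ (proj₂ t))))

  simulation : ∃ λ (M : RTM nA (suc nD)) → 𝑻 ↔bΔ 𝒯 M
  simulation = M , 𝓡 , (forth , back) ,
    at-index (subst (Rel init _) stack-[] (run⇒Rel {p = nothing} (run boot-run)))

-- A simulator for a boundedly branching computable system.

slotValue targetValue : ℕ → ℕ
slotValue c = ifz c 0 (suc (fstN (pred c)))
targetValue c = sndN (pred c)

slotValue-rec : Rec₁ slotValue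
slotValue-rec = rec₁ (app₃ ifz-rec (var (# 0)) (const 0)
  (app₁ suc-rec (app₁ fstN-rec (app₁ pred-rec (var (# 0))))))

targetValue-rec : Rec₁ targetValue
targetValue-rec = rec₁ (app₁ sndN-rec (app₁ pred-rec (var (# 0))))

module _ {nA : ℕ} (𝑻 : TS nA) (bb : BoundedlyBranching 𝑻) (cp : Computable 𝑻) where
  open TS 𝑻
  open Computable cp

  outValue : ℕ → ℕ
  outValue x = proj₁ (outF-tot x)

  outValue-rec : Rec₁ outValue
  outValue-rec = rec₁ (outF by λ { (x ∷ []) → proj₂ (outF-tot x) })

  link : ℕ → ℕ → ℕ
  link j x = chain (suc j) (outValue x)

  link-rec : ∀ j → Rec₁ (link j)
  link-rec j = rec₁ (app₁ (chain-rec (suc j)) (app₁ outValue-rec (var (# 0))))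

  slotF targetF : ℕ → PR 1
  slotF j = app₁ slotValue-rec (link-rec j .un₁) .prog
  targetF j = app₁ targetValue-rec (link-rec j .un₁) .prog

  slotF-eval : ∀ j x → slotF j [ x ∷ [] ]⇓ slotValue (link j x)
  slotF-eval j x = app₁ slotValue-rec (link-rec j .un₁) .eval (x ∷ [])

  targetF-eval : ∀ j x → targetF j [ x ∷ [] ]⇓ targetValue (link j x)
  targetF-eval j x = app₁ targetValue-rec (link-rec j .un₁) .eval (x ∷ [])

  edges : State → List ℕ
  edges s = proj₁ (outF-ok s)

  outValue-edges : ∀ s → outValue (code s) ≡ listCode (edges s)
  outValue-edges s = ⇓-functional (proj₂ (outF-tot (code s))) (proj₁ (proj₂ (outF-ok s)))

  edges-sound : ∀ s {m} → m ∈ edges s → ∃ λ a → ∃ λ t → s ⟶[ a ] t × m ≡ edgeCode 𝑻 code (a , t)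
  edges-sound s {m} = Equivalence.to (proj₂ (proj₂ (outF-ok s)) m)

  edges-complete : ∀ {s a t} → s ⟶[ a ] t → edgeCode 𝑻 code (a , t) ∈ edges s
  edges-complete {s} st = Equivalence.from (proj₂ (proj₂ (outF-ok s)) _) (_ , _ , st , refl)

  slotValue-edge : ∀ {a t} → slotValue (suc (edgeCode 𝑻 code (a , t))) ≡ suc (codeAct a)
  slotValue-edge {a} {t} = cong suc (fstN-pair (codeAct a) (code t))

  targetValue-edge : ∀ {a t} → targetValue (suc (edgeCode 𝑻 code (a , t))) ≡ code t
  targetValue-edge {a} {t} = sndN-pair (codeAct a) (code t)

  record Slot (s : State) (j : ℕ) : Set where
    field
      symbol : Fin (suc (suc nA))
      value  : slotValue (link j (code s)) ≡ toℕ symbol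
      offers : ∀ {a} → label symbol ≡ just a →
               ∃ λ t → s ⟶[ a ] t × targetF j [ code s ∷ [] ]⇓ code t
  open Slot

  -- Soundness of the scan is what makes the value fit into a finite label: a nonzero link codes a
  -- genuine edge, so its first component is the code of an action.
  slot : ∀ s j → Slot s j
  slot s j with scan-sound (chain j (listCode (edges s))) (edges s) (listCode (edges s)) | outValue-edges s
  ... | inj₁ c≡0 | oe = record
    { symbol = Fin.zero ; value = cong slotValue (trans (cong (chain (suc j)) oe) c≡0) ; offers = λ () }
  ... | inj₂ (h , h∈ , c≡h , _) | oe with edges-sound s h∈
  ...   | a , t , st , refl = record
    { symbol = unlabel a
    ; value = trans (cong slotValue link≡) (trans slotValue-edge (sym (toℕ-unlabel a)))
    ; offers = offered
    }
    where
    link≡ : link j (code s) ≡ suc (edgeCode 𝑻 code (a , t))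
    link≡ = trans (cong (chain (suc j)) oe) c≡h
    offered : ∀ {b} → label (unlabel a) ≡ just b → ∃ λ t → s ⟶[ b ] t × targetF j [ code s ∷ [] ]⇓ code t
    offered lab with just-injective (trans (sym (label-unlabel a)) lab)
    ... | refl = t , st ,
      subst (targetF j [ code s ∷ [] ]⇓_) (trans (cong targetValue link≡) (targetValue-edge {a} {t})) (targetF-eval j (code s))

  slot-complete : ∀ {s a t} → s ⟶[ a ] t → ∃ λ j → j < proj₁ bb ×
    label (slot s j .symbol) ≡ just a × targetF j [ code s ∷ [] ]⇓ code t
  slot-complete {s} {a} {t} st with chain-complete 𝑻 code s (proj₂ bb s) (edges-sound s) (edges-complete st)
  ... | j , j<B , c≡ = j , j<B ,
    -- The symbol is determined by its numeral, which the link fixes as that of `unlabel a`.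
    trans (cong label (toℕ-injective (trans (sym (slot s j .value))
      (trans (cong slotValue link≡) (trans slotValue-edge (sym (toℕ-unlabel a))))))) (label-unlabel a) ,
    subst (targetF j [ code s ∷ [] ]⇓_) (trans (cong targetValue link≡) (targetValue-edge {a} {t})) (targetF-eval j (code s))
    where
    link≡ : link j (code s) ≡ suc (edgeCode 𝑻 code (a , t))
    link≡ = trans (cong (chain (suc j)) (outValue-edges s)) c≡

  flag : State → Fin (suc (suc nA))
  flag s with finF-ok s
  ... | inj₁ _ = Fin.suc Fin.zero
  ... | inj₂ _ = Fin.zero

  flag-eval : ∀ s → finF [ code s ∷ [] ]⇓ toℕ (flag s)
  flag-eval s with finF-ok s
  ... | inj₁ (_ , p) = p
  ... | inj₂ (_ , p) = p

  flag-final : ∀ s → Final s → flag s ≡ Fin.suc Fin.zero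
  flag-final s F with finF-ok s
  ... | inj₁ _ = refl
  ... | inj₂ (¬F , _) = contradiction F ¬F

  final-flag : ∀ s {i} → flag s ≡ Fin.suc i → Final s
  final-flag s eq with finF-ok s
  ... | inj₁ (F , _) = F

  views : (s : State) → Vec (Fin (suc (suc nA))) (proj₁ bb)
  views s = tabulate λ j → slot s (toℕ j) .symbol

  lookup-views : ∀ s j → lookup (views s) j ≡ slot s (toℕ j) .symbol
  lookup-views s j = lookup∘tabulate _ j

  simulator : Simulator 𝑻
  simulator = record
    { code = code
    ; B = proj₁ bb
    ; senses = finF ∷ tabulate (λ j → slotF (toℕ j))
    ; target = λ j → targetF (toℕ j)
    ; view = λ s → flag s ∷ views s
    ; senses-view = senses-view
    ; final⇒ = flag-final
    ; final⇐ = final-flag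
    ; edge⇒ = edge⇒
    ; edge⇐ = λ s j lab → slot s (toℕ j) .offers (trans (sym (cong label (lookup-views s j))) lab)
    }
    where
    senses-view : ∀ s j → lookup (finF ∷ tabulate (λ j → slotF (toℕ j))) j [ code s ∷ [] ]⇓
      toℕ (lookup (flag s ∷ views s) j)
    senses-view s Fin.zero = flag-eval s
    senses-view s (Fin.suc j) = subst₂ (_[ code s ∷ [] ]⇓_) (sym (lookup∘tabulate (λ j → slotF (toℕ j)) j))
      (trans (slot s (toℕ j) .value) (cong toℕ (sym (lookup-views s j)))) (slotF-eval (toℕ j) (code s))
    edge⇒ : ∀ {s a t} → s ⟶[ a ] t → ∃ λ j →
      label (lookup (views s) j) ≡ just a × targetF (toℕ j) [ code s ∷ [] ]⇓ code t
    edge⇒ {s} {a} {t} st with slot-complete st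
    ... | j , j<B , lab , ev = fromℕ< j<B ,
      trans (cong label (lookup-views s (fromℕ< j<B)))
        (subst (λ i → label (slot s i .symbol) ≡ just a) (sym (toℕ-fromℕ< j<B)) lab) ,
      subst (λ i → targetF i [ code s ∷ [] ]⇓ code t) (sym (toℕ-fromℕ< j<B)) ev

theorem1 : ∀ (nA nD : ℕ) (𝑻 : TS nA) → BoundedlyBranching 𝑻 → Computable 𝑻 →
    ∃ λ (M : RTM nA (suc nD)) → 𝑻 ↔bΔ 𝒯 M
theorem1 nA nD 𝑻 bb cp = simulation nD 𝑻 (simulator 𝑻 bb cp)
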